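{- Let $\Gamma$ be a ribbon graph, $n$ a positive integer, $\Gamma^\flat_E$ the blowup of $\Gamma$ with its canonical perfect matching, $\langle\Gamma^\flat_E\rangle_n$ its $n$-bracket, and $P(\Gamma,k)$ the Penrose polynomial of $\Gamma$. For $n$ even, write $\langle\Gamma^\flat_E\rangle_n=\langle\Gamma^\flat_E\rangle_n(q,b)$; then $$\langle\Gamma^\flat_E\rangle_n(q,b)=\begin{cases}P(\Gamma,3n)&\text{when }q=b=1,\\ P(\Gamma,n)&\text{when }q=1,\ b=-1.\end{cases}$$ For $n$ odd, write $\langle\Gamma^\flat_E\rangle_n=\langle\Gamma^\flat_E\rangle_n(q)$; then $\langle\Gamma^\flat_E\rangle_n(1)=P(\Gamma,3n)$.
   Context: **Ribbon graphs.** Graphs are finite undirected multigraphs, connected with nonempty edge set. An (oriented) ribbon graph is a graph $G$ embedded in an oriented compact surface with boundary that deformation retracts onto $G$; equivalently, $G$ with a cyclic order of the half-edges at each vertex. It is represented by a ribbon diagram: a drawing of $G$ in the plane with vertices as dots and edges as curves that may cross, inducing the given cyclic orders counterclockwise. A perfect matching graph $\Gamma_M$ is a ribbon graph with a perfect matching $M$ of its underlying graph (each vertex is incident to exactly one edge of $M$). **Blowup.** The blowup $\Gamma^\flat$ of $\Gamma$ is the trivalent ribbon graph obtained by replacing every vertex of degree $d$ by a small circle carrying $d$ vertices, one at the end of each of the $d$ incident half-edges, in their cyclic order. The edges of the underlying graph of $\Gamma$ form the canonical perfect matching $E$ of $\Gamma^\flat$; this gives the perfect matching graph $\Gamma^\flat_E$.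 **Brackets.** Draw a matching edge $e$ of a trivalent perfect matching graph vertically, with the two other half-edges at its top vertex going up-left and up-right, and the two other half-edges at its bottom vertex going down-left and down-right. The 0-smoothing deletes $e$ and its endpoints and joins up-left with down-left and up-right with down-right; the 1-smoothing joins up-left with down-right and up-right with down-left. The bracket with parameters $A,B,C$ is determined by $\langle\Gamma_M\rangle=A\langle\text{0-smoothing at }e\rangle+B\langle\text{1-smoothing at }e\rangle$ for every matching edge $e$, $\langle\text{circle}\rangle=C$, and $\langle\Gamma_1\sqcup\Gamma_2\rangle=\langle\Gamma_1\rangle\langle\Gamma_2\rangle$. The $n$-bracket $\langle\cdot\rangle_n$ is the case $A=1$, $B=-1$, and $$C=\begin{cases}2(2+2q^2+\dots+2q^{n-2}+qb+q^3b+\dots+q^{n-1}b)&n\text{ even},\\3(1+q+\dots+q^{n-1})&n\text{ odd},\end{cases}$$ where $q^n=1$ and (for $n$ even) $b^2=1$. The Penrose polynomial $P(\Gamma,k)$ is the bracket of $\Gamma^\flat_E$ with $A=1$, $B=-1$, $C=k$. -}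

module Defs where

open import Algebra.Bundles using (CommutativeRing; RawRing; RawSemiring)
import Algebra.Definitions.RawSemiring as RawSemiringDefs
open import Algebra.Morphism.Structures using (module RingMorphisms)
open import Axiom.UniquenessOfIdentityProofs using (module Decidable⇒UIP)
open import Data.Bool.Base using (Bool; true; false; not; if_then_else_; T)
import Data.Bool.Properties as Bool
open import Data.Empty using (⊥-elim)
open import Data.Fin.Base using (Fin; zero; suc; toℕ)
open import Data.Fin.Patterns using (0F; 1F; 2F)
open import Data.Fin.Properties using (inj⇒≟; +↔⊎; *↔×; 2↔Bool)
open import Data.Integer.Base as ℤ using (ℤ; 0ℤ; 1ℤ; -1ℤ)
import Data.Integer.Properties as ℤ
open import Data.List.Base as List using (List; allFin; filterᵇ; length)
open import Data.Nat.Base as ℕ using (ℕ; zero; suc; ⌊_/2⌋)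
open import Data.Nat.GeneralisedArithmetic using (fold; fold-+)
open import Data.Product using (∃-syntax; ∃!; _×_; _,_; proj₁; proj₂)
open import Data.Product.Function.NonDependent.Propositional using (_×-↔_)
open import Data.Product.Properties using (≡-dec)
open import Data.Sum.Base using (_⊎_; inj₁; inj₂)
open import Data.Sum.Function.Propositional using (_⊎-↔_)
open import Data.Unit.Base using (⊤; tt)
open import Data.Vec.Base as Vec using (Vec; []; _∷_; lookup; removeAt; fromList)
open import Function.Base using (_∘_; id)
open import Function.Bundles using (_↔_; Inverse; mk↔ₛ′)
open import Function.Construct.Composition using (_↔-∘_)
open import Function.Construct.Symmetry using (↔-sym)
open import Function.Properties.Inverse using (↔⇒↣)
open import Level using (0ℓ)
open import Relation.Binary.Construct.Closure.ReflexiveTransitive using (Star; ε; _◅_; _◅◅_)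
open import Relation.Binary.Definitions using (DecidableEquality)
open import Relation.Binary.PropositionalEquality
  using (_≡_; _≢_; refl; sym; trans; cong; cong₂; subst)
import Relation.Binary.Reasoning.Setoid as SetoidReasoning
open import Relation.Nullary using (Dec; does; yes; no)

record Finite (A : Set) : Set where
  field
    size  : ℕ
    index : A ↔ Fin size

  elements : List A
  elements = List.map (Inverse.from index) (allFin size)

  infix 4 _≟_
  _≟_ : DecidableEquality A
  _≟_ = inj⇒≟ (↔⇒↣ index)

-- A half-edge is an edge together with one of its two ends, and `rot` sends a
-- half-edge to the next one counterclockwise around its vertex; `rot-vertex` and
-- `rot-cyclic` say that it acts on the half-edges at each vertex as one cycle.
record RibbonGraph : Set₁ where
  field
    Vertex       : Set
    Edge         : Set
    vertexFinite : Finite Vertex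
    edgeFinite   : Finite Edge
    end          : Edge → Bool → Vertex

  HalfEdge : Set
  HalfEdge = Edge × Bool

  vertex : HalfEdge → Vertex
  vertex (e , s) = end e s

  Adjacent : Vertex → Vertex → Set
  Adjacent u v = ∃[ e ] ∃[ s ] (end e s ≡ u × end e (not s) ≡ v)

  field
    rot        : HalfEdge ↔ HalfEdge
    rot-vertex : ∀ h → vertex (Inverse.to rot h) ≡ vertex h
    rot-cyclic : ∀ h h′ → vertex h ≡ vertex h′ →
                 ∃[ k ] fold h (Inverse.to rot) k ≡ h′
    connected  : ∀ u v → Star Adjacent u v
    someEdge   : Edge

  next prev : HalfEdge → HalfEdge
  next = Inverse.to rot
  prev = Inverse.from rot

  next-prev : ∀ h → next (prev h) ≡ h
  next-prev = Inverse.strictlyInverseˡ rot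

  prev-next : ∀ h → prev (next h) ≡ h
  prev-next = Inverse.strictlyInverseʳ rot

  open Finite edgeFinite public using () renaming (_≟_ to _≟E_)

  _≟H_ : DecidableEquality HalfEdge
  _≟H_ = ≡-dec _≟E_ Bool._≟_

  Trivalent : Set
  Trivalent = ∀ v → (∃[ h ] vertex h ≡ v) ↔ Fin 3

-- Uniqueness is required of the half-edge, so a matching edge is not a loop.
record PerfectMatching (Γ : RibbonGraph) : Set where
  open RibbonGraph Γ
  field
    matched : Edge → Bool
    perfect : ∀ v → ∃! _≡_ λ h → vertex h ≡ v × T (matched (proj₁ h))

record TrivalentMatchingGraph : Set₁ where
  field
    graph     : RibbonGraph
    trivalent : RibbonGraph.Trivalent graph
    matching  : PerfectMatching graph

-- The vertices of the blowup are the half-edges of Γ.  Its edges are the edges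
-- of Γ and, for every half-edge h, the arc of the circle from h to `next h`,
-- with end `true` at h and end `false` at `next h`.  With the circle traversed
-- counterclockwise and the edges of Γ leaving it outwards, the counterclockwise
-- order at h is: the edge of Γ, the arc leaving h, the arc arriving at h.
module Blowup (Γ : RibbonGraph) where
  open RibbonGraph Γ

  Vertex♭ Edge♭ HalfEdge♭ : Set
  Vertex♭   = HalfEdge
  Edge♭     = Edge ⊎ HalfEdge
  HalfEdge♭ = Edge♭ × Bool

  end♭ : Edge♭ → Bool → Vertex♭
  end♭ (inj₁ e) s     = e , s
  end♭ (inj₂ h) true  = h
  end♭ (inj₂ h) false = next h

  vertex♭ : HalfEdge♭ → Vertex♭
  vertex♭ (e , s) = end♭ e s

  next♭ prev♭ : HalfEdge♭ → HalfEdge♭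
  next♭ (inj₁ e , s)     = inj₂ (e , s) , true
  next♭ (inj₂ h , true)  = inj₂ (prev h) , false
  next♭ (inj₂ h , false) = inj₁ (proj₁ (next h)) , proj₂ (next h)
  prev♭ (inj₁ e , s)     = inj₂ (prev (e , s)) , false
  prev♭ (inj₂ h , true)  = inj₁ (proj₁ h) , proj₂ h
  prev♭ (inj₂ h , false) = inj₂ (next h) , true

  outer : HalfEdge → HalfEdge♭
  outer h = inj₁ (proj₁ h) , proj₂ h

  private
    next♭-prev♭ : ∀ h → next♭ (prev♭ h) ≡ h
    next♭-prev♭ (inj₁ e , s)     = cong outer (next-prev (e , s))
    next♭-prev♭ (inj₂ h , true)  = refl
    next♭-prev♭ (inj₂ h , false) = cong (λ g → inj₂ g , false) (prev-next h)

    prev♭-next♭ : ∀ h → prev♭ (next♭ h) ≡ h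
    prev♭-next♭ (inj₁ e , s)     = refl
    prev♭-next♭ (inj₂ h , true)  = cong (λ g → inj₂ g , true) (next-prev h)
    prev♭-next♭ (inj₂ h , false) = cong (λ g → inj₂ g , false) (prev-next h)

    rot-vertex♭ : ∀ h → vertex♭ (next♭ h) ≡ vertex♭ h
    rot-vertex♭ (inj₁ e , s)     = refl
    rot-vertex♭ (inj₂ h , true)  = next-prev h
    rot-vertex♭ (inj₂ h , false) = refl

    toOuter : ∀ h → ∃[ k ] fold h next♭ k ≡ outer (vertex♭ h)
    toOuter (inj₁ e , s)     = 0 , refl
    toOuter (inj₂ h , true)  = 2 , cong outer (next-prev h)
    toOuter (inj₂ h , false) = 1 , refl

    fromOuter : ∀ h → ∃[ k ] fold (outer (vertex♭ h)) next♭ k ≡ h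
    fromOuter (inj₁ e , s)     = 0 , refl
    fromOuter (inj₂ h , true)  = 1 , refl
    fromOuter (inj₂ h , false) = 2 , cong (λ g → inj₂ g , false) (prev-next h)

    rot-cyclic♭ : ∀ h h′ → vertex♭ h ≡ vertex♭ h′ → ∃[ k ] fold h next♭ k ≡ h′
    rot-cyclic♭ h h′ eq with toOuter h | fromOuter h′
    ... | k , p | l , r = l ℕ.+ k ,
      trans (fold-+ h next♭ l)
            (trans (cong (λ x → fold x next♭ l) (trans p (cong outer eq))) r)

    Adjacent♭ : Vertex♭ → Vertex♭ → Set
    Adjacent♭ u v = ∃[ e ] ∃[ s ] (end♭ e s ≡ u × end♭ e (not s) ≡ v)

    around : ∀ h k → Star Adjacent♭ h (fold h next k)
    around h zero    = ε
    around h (suc k) = around h k ◅◅ (inj₂ (fold h next k) , true , refl , refl) ◅ ε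

    along : ∀ {u v} → Star Adjacent u v →
            ∀ h h′ → vertex h ≡ u → vertex h′ ≡ v → Star Adjacent♭ h h′
    along ε h h′ p p′ with rot-cyclic h h′ (trans p (sym p′))
    ... | k , refl = around h k
    along ((e , s , q , q′) ◅ path) h h′ p p′ with rot-cyclic h (e , s) (trans p (sym q))
    ... | k , r =
      subst (Star Adjacent♭ h) r (around h k) ◅◅
      (inj₁ e , s , refl , refl) ◅
      along path (e , not s) h′ q′ p′

    halfEdgeFinite : Finite HalfEdge
    halfEdgeFinite = record
      { index = ↔-sym *↔× ↔-∘ (Finite.index edgeFinite ×-↔ ↔-sym 2↔Bool) }

  graph : RibbonGraph
  graph = record
    { Vertex       = Vertex♭
    ; Edge         = Edge♭
    ; vertexFinite = halfEdgeFinite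
    ; edgeFinite   = record
      { index = ↔-sym +↔⊎ ↔-∘ (Finite.index edgeFinite ⊎-↔ Finite.index halfEdgeFinite) }
    ; end          = end♭
    ; rot          = mk↔ₛ′ next♭ prev♭ next♭-prev♭ prev♭-next♭
    ; rot-vertex   = rot-vertex♭
    ; rot-cyclic   = rot-cyclic♭
    ; connected    = λ h h′ → along (connected (vertex h) (vertex h′)) h h′ refl refl
    ; someEdge     = inj₁ someEdge
    }

  private
    module UIP = Decidable⇒UIP _≟H_

    position : ∀ v → (∃[ h ] vertex♭ h ≡ v) → Fin 3
    position v ((inj₁ e , s) , _)     = 0F
    position v ((inj₂ h , true) , _)  = 1F
    position v ((inj₂ h , false) , _) = 2F

    atPosition : ∀ v → Fin 3 → ∃[ h ] vertex♭ h ≡ v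
    atPosition v 0F = outer v , refl
    atPosition v 1F = (inj₂ v , true) , refl
    atPosition v 2F = (inj₂ (prev v) , false) , next-prev v

    position-at : ∀ v i → position v (atPosition v i) ≡ i
    position-at v 0F = refl
    position-at v 1F = refl
    position-at v 2F = refl

    Σ-≡ : ∀ {v} {x y : ∃[ h ] vertex♭ h ≡ v} → proj₁ x ≡ proj₁ y → x ≡ y
    Σ-≡ {x = h , p} {y = _ , p′} refl = cong (h ,_) (UIP.≡-irrelevant p p′)

    at-position : ∀ v x → atPosition v (position v x) ≡ x
    at-position v ((inj₁ e , s) , refl)     = refl
    at-position v ((inj₂ h , true) , refl)  = refl
    at-position v ((inj₂ h , false) , refl) = Σ-≡ (cong (λ g → inj₂ g , false) (prev-next h))

  trivalent : RibbonGraph.Trivalent graph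
  trivalent v = mk↔ₛ′ (position v) (atPosition v) (position-at v) (at-position v)

  private
    isEdgeOfΓ : Edge♭ → Bool
    isEdgeOfΓ (inj₁ _) = true
    isEdgeOfΓ (inj₂ _) = false

    unique : ∀ v {h} → vertex♭ h ≡ v × T (isEdgeOfΓ (proj₁ h)) → outer v ≡ h
    unique v {inj₁ e , s} (refl , _) = refl

  matching : PerfectMatching graph
  matching = record
    { matched = isEdgeOfΓ
    ; perfect = λ v → outer v , (refl , tt) , unique v
    }

blowup : RibbonGraph → TrivalentMatchingGraph
blowup Γ = record { Blowup Γ }

-- The four half-edges around a matching edge drawn vertically, each recorded by
-- the edge it belongs to.
record Site (L : Set) : Set where
  field upLeft upRight downLeft downRight : L

-- What remains of a trivalent perfect matching graph with edges L after some
-- matching edges have been smoothed.  `sites` are the matching edges still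
-- present.  Smoothing joins edges end to end: `strand` sends each edge to a
-- representative of the curve it has become part of.  `circles` counts the
-- curves that have closed up.
record Diagram (L : Set) (n : ℕ) : Set where
  field
    sites   : Vec (Site L) n
    strand  : L → L
    circles : ℕ

module Smoothing {L : Set} (_≟_ : DecidableEquality L) where
  open Diagram

  merge : L → L → L → L
  merge a b x = if does (x ≟ b) then a else x

  -- Joins an end of the curve through a to an end of the curve through b; if
  -- these are the same curve, it closes up to a circle.
  join : ∀ {n} → L → L → Diagram L n → Diagram L n
  join a b D = record
    { sites   = sites D
    ; strand  = merge (strand D a) (strand D b) ∘ strand D
    ; circles = if does (strand D a ≟ strand D b) then suc (circles D) else circles D
    }

  delete : ∀ {n} → Fin (suc n) → Diagram L (suc n) → Diagram L n
  delete i D = record { sites = removeAt (sites D) i ; strand = strand D ; circles = circles D }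

  smooth₀ smooth₁ : ∀ {n} → Fin (suc n) → Diagram L (suc n) → Diagram L n
  smooth₀ i D = join upLeft downLeft (join upRight downRight (delete i D))
    where open Site (lookup (sites D) i)
  smooth₁ i D = join upLeft downRight (join upRight downLeft (delete i D))
    where open Site (lookup (sites D) i)

module _ (Γ : TrivalentMatchingGraph) where
  open TrivalentMatchingGraph Γ
  open RibbonGraph graph
  open PerfectMatching matching

  -- With end `true` of e at the top, the counterclockwise order is e, upRight,
  -- upLeft at the top and e, downLeft, downRight at the bottom.
  site : Edge → Site Edge
  site e = record
    { upRight   = proj₁ (next (e , true))
    ; upLeft    = proj₁ (next (next (e , true)))
    ; downLeft  = proj₁ (next (e , false))
    ; downRight = proj₁ (next (next (e , false)))
    }

  matchedEdges : List Edge
  matchedEdges = filterᵇ matched (Finite.elements edgeFinite)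

  diagram : Diagram Edge (length (List.map site matchedEdges))
  diagram = record
    { sites   = fromList (List.map site matchedEdges)
    ; strand  = id
    ; circles = 0
    }

module Bracket (R : CommutativeRing 0ℓ 0ℓ) (A B C : CommutativeRing.Carrier R) where
  open CommutativeRing R hiding (trans; zero)
    renaming (refl to ≈-refl; sym to ≈-sym; reflexive to ≈-reflexive)
  open RawSemiringDefs (RawRing.rawSemiring (CommutativeRing.rawRing R)) using (_^_)

  module _ {L : Set} (_≟_ : DecidableEquality L) where
    open Diagram
    open Smoothing _≟_

    -- Expands along the first matching edge; `expand` below shows that the
    -- smoothing relation then holds at every matching edge.  A disjoint union of
    -- circles has value C ^ circles by multiplicativity.
    evaluateDiagram : ∀ {n} → Diagram L n → Carrier
    evaluateDiagram {zero}  D = C ^ circles D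
    evaluateDiagram {suc n} D =
      A * evaluateDiagram (smooth₀ zero D) + B * evaluateDiagram (smooth₁ zero D)

  ⟨_⟩ : TrivalentMatchingGraph → Carrier
  ⟨ Γ ⟩ = evaluateDiagram (RibbonGraph._≟E_ (TrivalentMatchingGraph.graph Γ)) (diagram Γ)

  module Independence {L : Set} (_≟_ : DecidableEquality L) where
    open Diagram
    open Smoothing _≟_

    record _≅_ {n : ℕ} (D D′ : Diagram L n) : Set where
      field
        sites≡   : sites D ≡ sites D′
        circles≡ : circles D ≡ circles D′
        kernel⇒  : ∀ {x y} → strand D x ≡ strand D y → strand D′ x ≡ strand D′ y
        kernel⇐  : ∀ {x y} → strand D′ x ≡ strand D′ y → strand D x ≡ strand D y
    open _≅_

    private
      merge-snd : ∀ a b → merge a b b ≡ a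
      merge-snd a b with b ≟ b
      ... | yes _ = refl
      ... | no ¬p = ⊥-elim (¬p refl)

      merge-fst : ∀ a b → merge a b a ≡ a
      merge-fst a b with a ≟ b
      ... | yes _ = refl
      ... | no _  = refl

      merge-absorb : {Z : Set} (φ : L → Z) → ∀ {a b} → φ a ≡ φ b → ∀ x → φ (merge a b x) ≡ φ x
      merge-absorb φ {a} {b} eq x with x ≟ b
      ... | yes refl = eq
      ... | no _     = refl

      merge-same : ∀ a b → merge a b a ≡ merge a b b
      merge-same a b = trans (merge-fst a b) (sym (merge-snd a b))

      joined : ∀ {n} a b (D : Diagram L n) → strand (join a b D) a ≡ strand (join a b D) b
      joined a b D = merge-same (strand D a) (strand D b)

      join-least : ∀ {n} {a b} (D : Diagram L n) {Z : Set} (φ : L → Z) →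
                   (∀ {x y} → strand D x ≡ strand D y → φ x ≡ φ y) → φ a ≡ φ b →
                   ∀ {x y} → strand (join a b D) x ≡ strand (join a b D) y → φ x ≡ φ y
      join-least {a = a} {b} D φ ker ab {x} {y} with strand D x ≟ strand D b | strand D y ≟ strand D b
      ... | yes p | yes q = λ _ → ker (trans p (sym q))
      ... | yes p | no _  = λ r → trans (ker p) (trans (sym ab) (ker r))
      ... | no _  | yes q = λ r → trans (ker r) (trans ab (sym (ker q)))
      ... | no _  | no _  = λ r → ker r

      join-ker : ∀ {n} a b (D : Diagram L n) {x y} →
                 strand D x ≡ strand D y → strand (join a b D) x ≡ strand (join a b D) y
      join-ker a b D = cong (merge (strand D a) (strand D b))

      bump : L → L → ℕ → ℕ
      bump x y c = if does (x ≟ y) then suc c else c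

      bump-cong : ∀ {x y x′ y′} → (x ≡ y → x′ ≡ y′) → (x′ ≡ y′ → x ≡ y) →
                  ∀ c → bump x y c ≡ bump x′ y′ c
      bump-cong {x} {y} {x′} {y′} f g c with x ≟ y | x′ ≟ y′
      ... | yes _ | yes _ = refl
      ... | yes p | no ¬q = ⊥-elim (¬q (f p))
      ... | no ¬p | yes q = ⊥-elim (¬p (g q))
      ... | no _  | no _  = refl

      join-cong : ∀ {n} a b {D D′ : Diagram L n} → D ≅ D′ → join a b D ≅ join a b D′
      join-cong a b {D} {D′} eq = record
        { sites≡   = sites≡ eq
        ; circles≡ = trans (bump-cong (kernel⇒ eq) (kernel⇐ eq) (circles D))
                           (cong (bump (strand D′ a) (strand D′ b)) (circles≡ eq))
        ; kernel⇒  = join-least D (strand (join a b D′))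
                       (λ p → join-ker a b D′ (kernel⇒ eq p)) (joined a b D′)
        ; kernel⇐  = join-least D′ (strand (join a b D))
                       (λ p → join-ker a b D (kernel⇐ eq p)) (joined a b D)
        }

      join-swap-ker : ∀ {n} a b c d (D : Diagram L n) {x y} →
        strand (join a b (join c d D)) x ≡ strand (join a b (join c d D)) y →
        strand (join c d (join a b D)) x ≡ strand (join c d (join a b D)) y
      join-swap-ker a b c d D =
        join-least (join c d D) (strand E)
          (join-least D (strand E)
            (λ p → join-ker c d (join a b D) (join-ker a b D p))
            (joined c d (join a b D)))
          (join-ker c d (join a b D) (joined a b D))
        where E = join c d (join a b D)

      merge-crosses : ∀ a b c d → c ≢ d → merge a b c ≡ merge a b d → merge c d a ≡ merge c d b
      merge-crosses a b c d c≢d eq with c ≟ b | d ≟ b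
      ... | yes refl | yes refl = ⊥-elim (c≢d refl)
      ... | yes refl | no _     = subst (λ z → merge c z a ≡ merge c z c) eq (sym (merge-same c a))
      ... | no _     | yes refl = subst (λ z → merge z d a ≡ merge z d d) (sym eq) (merge-same a d)
      ... | no _     | no _     = ⊥-elim (c≢d eq)

      merge-trivial : ∀ {a b} → a ≡ b → ∀ x → merge a b x ≡ x
      merge-trivial refl = merge-absorb id refl

      bump-trivial : ∀ {a b} → a ≡ b → ∀ c d m →
                     bump (merge a b c) (merge a b d) m ≡ bump c d m
      bump-trivial eq c d m = cong₂ (λ x y → bump x y m) (merge-trivial eq c) (merge-trivial eq d)

      bump-yes : ∀ {x y} → x ≡ y → ∀ m → bump x y m ≡ suc m
      bump-yes {x} {y} p m with x ≟ y
      ... | yes _ = refl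
      ... | no ¬p = ⊥-elim (¬p p)

      bump-no : ∀ {x y} → x ≢ y → ∀ m → bump x y m ≡ m
      bump-no {x} {y} ¬p m with x ≟ y
      ... | yes p = ⊥-elim (¬p p)
      ... | no _  = refl

      bump-suc : ∀ x y m → bump x y (suc m) ≡ suc (bump x y m)
      bump-suc x y m with x ≟ y
      ... | yes _ = refl
      ... | no _  = refl

      bump-swap : ∀ a b c d m →
        bump (merge c d a) (merge c d b) (bump c d m) ≡
        bump (merge a b c) (merge a b d) (bump a b m)
      bump-swap a b c d m = aux (a ≟ b) (c ≟ d)
        where
        aux : Dec (a ≡ b) → Dec (c ≡ d) →
              bump (merge c d a) (merge c d b) (bump c d m) ≡
              bump (merge a b c) (merge a b d) (bump a b m)
        aux (yes p) _ =
          trans (bump-yes (cong (merge c d) p) _)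
          (sym (trans (bump-trivial p c d _)
                (trans (cong (bump c d) (bump-yes p m)) (bump-suc c d m))))
        aux (no _) (yes q) =
          trans (bump-trivial q a b _)
          (trans (cong (bump a b) (bump-yes q m))
          (trans (bump-suc a b m) (sym (bump-yes (cong (merge a b) q) _))))
        aux (no ¬p) (no ¬q) =
          trans (cong (bump (merge c d a) (merge c d b)) (bump-no ¬q m))
          (trans (bump-cong (merge-crosses c d a b ¬p) (merge-crosses a b c d ¬q) m)
          (sym (cong (bump (merge a b c) (merge a b d)) (bump-no ¬p m))))

      join-swap : ∀ {n} a b c d (D : Diagram L n) →
                  join a b (join c d D) ≅ join c d (join a b D)
      join-swap a b c d D = record
        { sites≡   = refl
        ; circles≡ = bump-swap (strand D a) (strand D b) (strand D c) (strand D d) (circles D)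
        ; kernel⇒  = join-swap-ker a b c d D
        ; kernel⇐  = join-swap-ker c d a b D
        }

      ≅-trans : ∀ {n} {D E F : Diagram L n} → D ≅ E → E ≅ F → D ≅ F
      ≅-trans p r = record
        { sites≡   = trans (sites≡ p) (sites≡ r)
        ; circles≡ = trans (circles≡ p) (circles≡ r)
        ; kernel⇒  = λ x → kernel⇒ r (kernel⇒ p x)
        ; kernel⇐  = λ x → kernel⇐ p (kernel⇐ r x)
        }

      joins-swap : ∀ {n} a b c d a′ b′ c′ d′ (D : Diagram L n) →
        join a b (join c d (join a′ b′ (join c′ d′ D))) ≅
        join a′ b′ (join c′ d′ (join a b (join c d D)))
      joins-swap a b c d a′ b′ c′ d′ D =
        ≅-trans (join-cong a b (join-swap c d a′ b′ (join c′ d′ D)))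
        (≅-trans (join-swap a b a′ b′ (join c d (join c′ d′ D)))
        (≅-trans (join-cong a′ b′ (join-cong a b (join-swap c d c′ d′ D)))
                 (join-cong a′ b′ (join-swap a b c′ d′ (join c d D)))))

      delete-cong : ∀ {n} i {D D′ : Diagram L (suc n)} → D ≅ D′ → delete i D ≅ delete i D′
      delete-cong i eq = record
        { sites≡   = cong (λ s → removeAt s i) (sites≡ eq)
        ; circles≡ = circles≡ eq
        ; kernel⇒  = kernel⇒ eq
        ; kernel⇐  = kernel⇐ eq
        }

      smooth₀-cong : ∀ {n} i {D D′ : Diagram L (suc n)} → D ≅ D′ → smooth₀ i D ≅ smooth₀ i D′
      smooth₀-cong i {D@record {}} {D′@record {}} eq with refl ← sites≡ eq =
        join-cong _ _ (join-cong _ _ (delete-cong i {D} {D′} eq))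

      smooth₁-cong : ∀ {n} i {D D′ : Diagram L (suc n)} → D ≅ D′ → smooth₁ i D ≅ smooth₁ i D′
      smooth₁-cong i {D@record {}} {D′@record {}} eq with refl ← sites≡ eq =
        join-cong _ _ (join-cong _ _ (delete-cong i {D} {D′} eq))

    ⟪_⟫ : ∀ {n} → Diagram L n → Carrier
    ⟪_⟫ = evaluateDiagram _≟_

    evaluate-cong : ∀ {n} {D D′ : Diagram L n} → D ≅ D′ → ⟪ D ⟫ ≈ ⟪ D′ ⟫
    evaluate-cong {zero}  eq = ≈-reflexive (cong (C ^_) (circles≡ eq))
    evaluate-cong {suc n} eq =
      +-cong (*-congˡ (evaluate-cong (smooth₀-cong zero eq)))
             (*-congˡ (evaluate-cong (smooth₁-cong zero eq)))

    private
      exchange : ∀ x y z w → A * (A * x + B * y) + B * (A * z + B * w) ≈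
                             A * (A * x + B * z) + B * (A * y + B * w)
      exchange x y z w = begin
        A * (A * x + B * y) + B * (A * z + B * w)
          ≈⟨ +-cong (distribˡ _ _ _) (distribˡ _ _ _) ⟩
        (A * (A * x) + A * (B * y)) + (B * (A * z) + B * (B * w))
          ≈⟨ middleFour _ _ _ _ ⟩
        (A * (A * x) + B * (A * z)) + (A * (B * y) + B * (B * w))
          ≈⟨ +-cong (+-congˡ (swap z)) (+-congʳ (≈-sym (swap y))) ⟩
        (A * (A * x) + A * (B * z)) + (B * (A * y) + B * (B * w))
          ≈⟨ +-cong (distribˡ _ _ _) (distribˡ _ _ _) ⟨
        A * (A * x + B * z) + B * (A * y + B * w) ∎
        where
        open SetoidReasoning setoid
        open import Algebra.Properties.CommutativeSemigroup
          (CommutativeRing.*-commutativeSemigroup R) using (x∙yz≈y∙xz)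
        open import Algebra.Properties.CommutativeSemigroup
          (CommutativeRing.+-commutativeSemigroup R) using () renaming (interchange to middleFour)
        swap : ∀ u → B * (A * u) ≈ A * (B * u)
        swap u = x∙yz≈y∙xz B A u

    expand : ∀ {n} i (D : Diagram L (suc n)) →
             ⟪ D ⟫ ≈ A * ⟪ smooth₀ i D ⟫ + B * ⟪ smooth₁ i D ⟫
    expand zero D = ≈-refl
    expand {suc n} (suc i) D@record { sites = s ∷ t ∷ ss } = begin
      A * ⟪ smooth₀ zero D ⟫ + B * ⟪ smooth₁ zero D ⟫
        ≈⟨ +-cong (*-congˡ (expand i (smooth₀ zero D))) (*-congˡ (expand i (smooth₁ zero D))) ⟩
      A * (A * ⟪ smooth₀ i (smooth₀ zero D) ⟫ + B * ⟪ smooth₁ i (smooth₀ zero D) ⟫) +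
      B * (A * ⟪ smooth₀ i (smooth₁ zero D) ⟫ + B * ⟪ smooth₁ i (smooth₁ zero D) ⟫)
        ≈⟨ exchange _ _ _ _ ⟩
      A * (A * ⟪ smooth₀ i (smooth₀ zero D) ⟫ + B * ⟪ smooth₀ i (smooth₁ zero D) ⟫) +
      B * (A * ⟪ smooth₁ i (smooth₀ zero D) ⟫ + B * ⟪ smooth₁ i (smooth₁ zero D) ⟫)
        ≈⟨ +-cong (*-congˡ (+-cong (*-congˡ (evaluate-cong swap)) (*-congˡ (evaluate-cong swap))))
                  (*-congˡ (+-cong (*-congˡ (evaluate-cong swap)) (*-congˡ (evaluate-cong swap)))) ⟩
      A * ⟪ smooth₀ (suc i) D ⟫ + B * ⟪ smooth₁ (suc i) D ⟫ ∎
      where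
      open SetoidReasoning setoid
      D′ : Diagram L n
      D′ = record { sites = removeAt (t ∷ ss) i ; strand = strand D ; circles = circles D }
      swap : ∀ {a b c d a′ b′ c′ d′} →
             join a b (join c d (join a′ b′ (join c′ d′ D′))) ≅
             join a′ b′ (join c′ d′ (join a b (join c d D′)))
      swap = joins-swap _ _ _ _ _ _ _ _ D′

infixl 6 _:+_
infixl 7 _:*_
infix  8 :-_

-- Commutative rings given by generators and relations: terms modulo the
-- congruence generated by the ring axioms and the relations.
data Term (X : Set) : Set where
  var       : X → Term X
  _:+_ _:*_ : Term X → Term X → Term X
  :-_       : Term X → Term X
  :0 :1     : Term X

module Presented {X : Set} (_∼_ : Term X → Term X → Set) where

  infix 4 _≈_
  data _≈_ : Term X → Term X → Set where
    relation    : ∀ {x y} → x ∼ y → x ≈ y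
    ≈-refl      : ∀ {x} → x ≈ x
    ≈-sym       : ∀ {x y} → x ≈ y → y ≈ x
    ≈-trans     : ∀ {x y z} → x ≈ y → y ≈ z → x ≈ z
    +-cong      : ∀ {x x′ y y′} → x ≈ x′ → y ≈ y′ → (x :+ y) ≈ (x′ :+ y′)
    *-cong      : ∀ {x x′ y y′} → x ≈ x′ → y ≈ y′ → (x :* y) ≈ (x′ :* y′)
    -‿cong      : ∀ {x x′} → x ≈ x′ → (:- x) ≈ (:- x′)
    +-assoc     : ∀ x y z → ((x :+ y) :+ z) ≈ (x :+ (y :+ z))
    +-comm      : ∀ x y → (x :+ y) ≈ (y :+ x)
    +-identityˡ : ∀ x → (:0 :+ x) ≈ x
    -‿inverseˡ  : ∀ x → ((:- x) :+ x) ≈ :0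
    *-assoc     : ∀ x y z → ((x :* y) :* z) ≈ (x :* (y :* z))
    *-comm      : ∀ x y → (x :* y) ≈ (y :* x)
    *-identityˡ : ∀ x → (:1 :* x) ≈ x
    distribˡ    : ∀ x y z → (x :* (y :+ z)) ≈ ((x :* y) :+ (x :* z))

  commutativeRing : CommutativeRing 0ℓ 0ℓ
  commutativeRing = record
    { Carrier = Term X ; _≈_ = _≈_ ; _+_ = _:+_ ; _*_ = _:*_ ; -_ = :-_ ; 0# = :0 ; 1# = :1
    ; isCommutativeRing = record
      { isRing = record
        { +-isAbelianGroup = record
          { isGroup = record
            { isMonoid = record
              { isSemigroup = record
                { isMagma = record
                  { isEquivalence = record { refl = ≈-refl ; sym = ≈-sym ; trans = ≈-trans }
                  ; ∙-cong = +-cong }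
                ; assoc = +-assoc }
              ; identity = +-identityˡ , λ x → ≈-trans (+-comm x :0) (+-identityˡ x) }
            ; inverse = -‿inverseˡ , λ x → ≈-trans (+-comm x (:- x)) (-‿inverseˡ x)
            ; ⁻¹-cong = -‿cong }
          ; comm = +-comm }
        ; *-cong = *-cong
        ; *-assoc = *-assoc
        ; *-identity = *-identityˡ , λ x → ≈-trans (*-comm x :1) (*-identityˡ x)
        ; distrib = distribˡ , λ x y z →
            ≈-trans (*-comm (y :+ z) x)
            (≈-trans (distribˡ x y z) (+-cong (*-comm x y) (*-comm x z))) }
      ; *-comm = *-comm } }

termRawSemiring : Set → RawSemiring 0ℓ 0ℓ
termRawSemiring X = record
  { Carrier = Term X ; _≈_ = _≡_ ; _+_ = _:+_ ; _*_ = _:*_ ; 0# = :0 ; 1# = :1 }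

module _ {X : Set} where
  open RawSemiringDefs (termRawSemiring X) public
    using (_^_; sum) renaming (_×_ to _·_)

interpret : {X : Set} → (X → ℤ) → Term X → ℤ
interpret ρ (var x)  = ρ x
interpret ρ (x :+ y) = interpret ρ x ℤ.+ interpret ρ y
interpret ρ (x :* y) = interpret ρ x ℤ.* interpret ρ y
interpret ρ (:- x)   = ℤ.- interpret ρ x
interpret ρ :0       = 0ℤ
interpret ρ :1       = 1ℤ

-- An assignment of integers to the generators at which the relations hold.
record Point {X : Set} (_∼_ : Term X → Term X → Set) : Set where
  field
    coordinate : X → ℤ
    satisfies  : ∀ {x y} → x ∼ y → interpret coordinate x ≡ interpret coordinate y

module _ {X : Set} {_∼_ : Term X → Term X → Set} (p : Point _∼_) where
  open Point p
  open Presented _∼_ using (_≈_; commutativeRing)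
  open Presented._≈_

  evaluateAt : Term X → ℤ
  evaluateAt = interpret coordinate

  evaluateAt-cong : ∀ {x y} → x ≈ y → evaluateAt x ≡ evaluateAt y
  evaluateAt-cong (relation r)      = satisfies r
  evaluateAt-cong ≈-refl            = refl
  evaluateAt-cong (≈-sym r)         = sym (evaluateAt-cong r)
  evaluateAt-cong (≈-trans r s)     = trans (evaluateAt-cong r) (evaluateAt-cong s)
  evaluateAt-cong (+-cong r s)      = cong₂ ℤ._+_ (evaluateAt-cong r) (evaluateAt-cong s)
  evaluateAt-cong (*-cong r s)      = cong₂ ℤ._*_ (evaluateAt-cong r) (evaluateAt-cong s)
  evaluateAt-cong (-‿cong r)        = cong ℤ.-_ (evaluateAt-cong r)
  evaluateAt-cong (+-assoc x y z)   = ℤ.+-assoc (evaluateAt x) _ _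
  evaluateAt-cong (+-comm x y)      = ℤ.+-comm (evaluateAt x) _
  evaluateAt-cong (+-identityˡ x)   = ℤ.+-identityˡ _
  evaluateAt-cong (-‿inverseˡ x)    = ℤ.+-inverseˡ (evaluateAt x)
  evaluateAt-cong (*-assoc x y z)   = ℤ.*-assoc (evaluateAt x) _ _
  evaluateAt-cong (*-comm x y)      = ℤ.*-comm (evaluateAt x) _
  evaluateAt-cong (*-identityˡ x)   = ℤ.*-identityˡ _
  evaluateAt-cong (distribˡ x y z)  = ℤ.*-distribˡ-+ (evaluateAt x) _ _

  open RingMorphisms (CommutativeRing.rawRing commutativeRing)
                     (CommutativeRing.rawRing ℤ.+-*-commutativeRing)

  evaluateAt-isRingHomomorphism : IsRingHomomorphism evaluateAt
  evaluateAt-isRingHomomorphism = record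
    { isSemiringHomomorphism = record
      { isNearSemiringHomomorphism = record
        { +-isMonoidHomomorphism = record
          { isMagmaHomomorphism = record
            { isRelHomomorphism = record { cong = evaluateAt-cong }
            ; homo = λ _ _ → refl }
          ; ε-homo = refl }
        ; *-homo = λ _ _ → refl }
      ; 1#-homo = refl }
    ; -‿homo = λ _ → refl }

data NoRelation : Term ⊤ → Term ⊤ → Set where

ℤ[k] : CommutativeRing 0ℓ 0ℓ
ℤ[k] = Presented.commutativeRing NoRelation

penrose : RibbonGraph → CommutativeRing.Carrier ℤ[k]
penrose Γ = ⟨ blowup Γ ⟩
  where open Bracket ℤ[k] :1 (:- :1) (var tt)

P : RibbonGraph → ℤ → ℤ
P Γ k = evaluateAt {_∼_ = NoRelation} (record { coordinate = λ _ → k ; satisfies = λ () }) (penrose Γ)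

data QB : Set where
  q b : QB

data EvenRelation (n : ℕ) : Term QB → Term QB → Set where
  qⁿ∼1 : EvenRelation n (var q ^ n) :1
  b²∼1 : EvenRelation n (var b ^ 2) :1

-- ℤ[q,b]/(qⁿ − 1, b² − 1)
EvenRing : ℕ → CommutativeRing 0ℓ 0ℓ
EvenRing n = Presented.commutativeRing (EvenRelation n)

evenCircle : (n : ℕ) → CommutativeRing.Carrier (EvenRing n)
evenCircle n = 2 · sum {n = ⌊ n /2⌋} λ i →
  2 · (var q ^ (2 ℕ.* toℕ i)) :+ var q ^ suc (2 ℕ.* toℕ i) :* var b

evenBracket : (n : ℕ) → TrivalentMatchingGraph → CommutativeRing.Carrier (EvenRing n)
evenBracket n = Bracket.⟨_⟩ (EvenRing n) :1 (:- :1) (evenCircle n)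

data Q : Set where
  q : Q

data OddRelation (n : ℕ) : Term Q → Term Q → Set where
  qⁿ∼1 : OddRelation n (var q ^ n) :1

-- ℤ[q]/(qⁿ − 1)
OddRing : ℕ → CommutativeRing 0ℓ 0ℓ
OddRing n = Presented.commutativeRing (OddRelation n)

oddCircle : (n : ℕ) → CommutativeRing.Carrier (OddRing n)
oddCircle n = 3 · sum {n = n} λ i → var q ^ toℕ i

oddBracket : (n : ℕ) → TrivalentMatchingGraph → CommutativeRing.Carrier (OddRing n)
oddBracket n = Bracket.⟨_⟩ (OddRing n) :1 (:- :1) (oddCircle n)

private
  interpret-1^ : {X : Set} {ρ : X → ℤ} (x : X) → ρ x ≡ 1ℤ → ∀ n → interpret ρ (var x ^ n) ≡ 1ℤ
  interpret-1^ x p zero    = refl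
  interpret-1^ x p (suc n) = cong₂ ℤ._*_ p (interpret-1^ x p n)

evenPoint : ∀ n (β : ℤ) → β ℤ.* β ≡ 1ℤ → Point (EvenRelation n)
evenPoint n β β² = record { coordinate = ρ ; satisfies = sat }
  where
  ρ : QB → ℤ
  ρ q = 1ℤ
  ρ b = β

  sat : ∀ {x y} → EvenRelation n x y → interpret ρ x ≡ interpret ρ y
  sat qⁿ∼1 = interpret-1^ q refl n
  sat b²∼1 = trans (cong (β ℤ.*_) (ℤ.*-identityʳ β)) β²

q=1,b=1 q=1,b=-1 : ∀ n → Point (EvenRelation n)
q=1,b=1  n = evenPoint n 1ℤ refl
q=1,b=-1 n = evenPoint n -1ℤ refl

q=1 : ∀ n → Point (OddRelation n)
q=1 n = record { coordinate = λ _ → 1ℤ ; satisfies = λ { qⁿ∼1 → interpret-1^ q refl n } }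

{-# OPTIONS --safe #-}
-- The bracket is a polynomial in A, B, C with integer coefficients, so it commutes
-- with ring homomorphisms and depends, after evaluation at a point, only on the
-- value of the circle there.  With b² = 1 and q = 1 that value is n(2 + b) for n
-- even, that is 3n or n, and it is 3n for n odd.
module Submission where

open import Defs
open import Algebra.Bundles using (CommutativeRing; RawRing)
import Algebra.Definitions.RawSemiring as RawSemiringDefs
open import Algebra.Morphism.Structures using (module RingMorphisms)
open import Data.Fin.Base using (Fin; zero; suc; toℕ)
open import Data.Integer.Base as ℤ using (ℤ; +_; 1ℤ; -1ℤ)
import Data.Integer.Properties as ℤ
open import Data.Nat.Base as ℕ using (ℕ; zero; suc; NonZero; _*_; ⌊_/2⌋)
open import Data.Nat.Divisibility using (_∣_; _∤_; divides)
import Data.Nat.Properties as ℕ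
open import Data.Product.Base using (_×_; _,_)
open import Data.Unit.Base using (tt)
open import Function.Base using (_∘_)
open import Level using (0ℓ)
open import Relation.Binary.Definitions using (DecidableEquality)
open import Relation.Binary.PropositionalEquality
  using (_≡_; refl; sym; trans; cong; cong₂; module ≡-Reasoning)

module _ (R S : CommutativeRing 0ℓ 0ℓ) where
  private
    module R = CommutativeRing R
    module S = CommutativeRing S
    open RawSemiringDefs (RawRing.rawSemiring R.rawRing) using () renaming (_^_ to _^ᴿ_)
    open RawSemiringDefs (RawRing.rawSemiring S.rawRing) using () renaming (_^_ to _^ˢ_)
  open RingMorphisms R.rawRing S.rawRing

  module _ {f : R.Carrier → S.Carrier} (f-hom : IsRingHomomorphism f) where
    open IsRingHomomorphism f-hom using (+-homo; *-homo; 1#-homo)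

    ^-homo : ∀ x m → f (x ^ᴿ m) S.≈ f x ^ˢ m
    ^-homo x zero    = 1#-homo
    ^-homo x (suc m) = S.trans (*-homo x _) (S.*-congˡ (^-homo x m))

    -- Diagrams contain no ring elements, so the same recursion on smoothings runs over both rings,
    -- and `f` only has to pass through its sums, products and final powers of `C`.
    evaluateDiagram-homo :
      ∀ A B C {L : Set} (_≟_ : DecidableEquality L) {m} (D : Diagram L m) →
      f (Bracket.evaluateDiagram R A B C _≟_ D) S.≈
      Bracket.evaluateDiagram S (f A) (f B) (f C) _≟_ D
    evaluateDiagram-homo A B C _≟_ {zero}  D = ^-homo C (Diagram.circles D)
    evaluateDiagram-homo A B C _≟_ {suc m} D = S.trans (+-homo _ _)
      (S.+-cong (S.trans (*-homo A _) (S.*-congˡ (evaluateDiagram-homo A B C _≟_ (smooth₀ zero D))))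
                (S.trans (*-homo B _) (S.*-congˡ (evaluateDiagram-homo A B C _≟_ (smooth₁ zero D)))))
      where open Smoothing _≟_

-- Common form of `penrose`, `evenBracket` and `oddBracket`, which differ only in the presentation
-- and the value of the circle; each is an instance by unfolding.
penroseBracket : {X : Set} (_∼_ : Term X → Term X → Set) → Term X →
                 TrivalentMatchingGraph → Term X
penroseBracket _∼_ C = Bracket.⟨_⟩ (Presented.commutativeRing _∼_) :1 (:- :1) C

evaluateAt-penroseBracket :
  {X : Set} {_∼_ : Term X → Term X → Set} (p : Point _∼_) (C : Term X)
  (Γ : RibbonGraph) {k : ℤ} → evaluateAt p C ≡ k →
  evaluateAt p (penroseBracket _∼_ C (blowup Γ)) ≡ P Γ k
evaluateAt-penroseBracket {_∼_ = _∼_} p C Γ {k} refl =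
  -- `P Γ k` is itself such an evaluation, with circle `var tt` sent to `k`. Both sides thus equal
  -- the integer bracket with parameters 1, -1 and `k`.
  trans (homo p C) (sym (homo k-point (var tt)))
  where
  k-point : Point NoRelation
  k-point = record { coordinate = λ _ → k ; satisfies = λ () }

  -- Stated for any presentation, since it is applied both to the given one and to the free one
  -- behind `P`.
  homo : {X : Set} {_∼_ : Term X → Term X → Set} (p : Point _∼_) (C : Term X) →
         evaluateAt p (penroseBracket _∼_ C (blowup Γ)) ≡
         Bracket.⟨_⟩ ℤ.+-*-commutativeRing 1ℤ -1ℤ (evaluateAt p C) (blowup Γ)
  homo {_∼_ = _∼_} p C = evaluateDiagram-homo
    (Presented.commutativeRing _∼_) ℤ.+-*-commutativeRing
    (evaluateAt-isRingHomomorphism p) :1 (:- :1) C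
    (RibbonGraph._≟E_ (Blowup.graph Γ)) (diagram (blowup Γ))

module _ {X : Set} (ρ : X → ℤ) where

  interpret-· : ∀ m x → interpret ρ (m · x) ≡ + m ℤ.* interpret ρ x
  interpret-· zero    x = refl
  interpret-· (suc m) x = trans (cong (ℤ._+_ (interpret ρ x)) (interpret-· m x))
                                (sym (ℤ.suc-* (+ m) (interpret ρ x)))

  interpret-sum : ∀ m (t : Fin m → Term X) {c} → (∀ i → interpret ρ (t i) ≡ c) →
                  interpret ρ (sum t) ≡ + m ℤ.* c
  interpret-sum zero    t     eq = refl
  interpret-sum (suc m) t {c} eq =
    trans (cong₂ ℤ._+_ (eq zero) (interpret-sum m (t ∘ suc) (eq ∘ suc)))
          (sym (ℤ.suc-* (+ m) c))

  interpret-^ : ∀ x m → interpret ρ x ≡ 1ℤ → interpret ρ (x ^ m) ≡ 1ℤ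
  interpret-^ x zero    eq = refl
  interpret-^ x (suc m) eq = cong₂ ℤ._*_ eq (interpret-^ x m eq)

-- The factor 2 stands on the right, as in `divides`; each step in `m` then adds two successors,
-- which halving turns into one.
⌊m*2/2⌋≡m : ∀ m → ⌊ m * 2 /2⌋ ≡ m
⌊m*2/2⌋≡m zero    = refl
⌊m*2/2⌋≡m (suc m) = cong suc (⌊m*2/2⌋≡m m)

-- At `q = 1` each of the `n / 2` summands becomes `2 + b`, and the outer factor 2 restores `n`.
-- Taking `c` as a parameter covers both signs of `b`.
interpret-evenCircle : ∀ {n} (ρ : QB → ℤ) → ρ q ≡ 1ℤ → 2 ∣ n → ∀ c → + 2 ℤ.+ ρ b ≡ + c →
                       interpret ρ (evenCircle n) ≡ + (c * n)
interpret-evenCircle ρ ρq (divides m refl) c eq = begin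
  interpret ρ (evenCircle (m * 2))
    ≡⟨ interpret-· ρ 2 (sum summand) ⟩
  + 2 ℤ.* interpret ρ (sum summand)
    ≡⟨ cong (+ 2 ℤ.*_) (interpret-sum ρ ⌊ m * 2 /2⌋ summand summand≡c) ⟩
  + 2 ℤ.* (+ ⌊ m * 2 /2⌋ ℤ.* + c)
    ≡⟨ cong (λ h → + 2 ℤ.* (+ h ℤ.* + c)) (⌊m*2/2⌋≡m m) ⟩
  + 2 ℤ.* (+ m ℤ.* + c)
    ≡⟨ cong (+ 2 ℤ.*_) (ℤ.pos-* m c) ⟨
  + 2 ℤ.* + (m * c)
    ≡⟨ ℤ.pos-* 2 (m * c) ⟨
  + (2 * (m * c))
    ≡⟨ cong +_ (trans (sym (ℕ.*-assoc 2 m c))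
               (trans (ℕ.*-comm (2 * m) c) (cong (c *_) (ℕ.*-comm 2 m)))) ⟩
  + (c * (m * 2)) ∎
  where
  open ≡-Reasoning

  summand : Fin ⌊ m * 2 /2⌋ → Term QB
  summand i = 2 · (var q ^ (2 * toℕ i)) :+ var q ^ suc (2 * toℕ i) :* var b

  summand≡c : ∀ i → interpret ρ (summand i) ≡ + c
  summand≡c i = trans
    (cong₂ ℤ._+_
      -- This is the shape to which `2 · x` unfolds; at `z = 1` it computes to 2.
      (cong (λ z → z ℤ.+ (z ℤ.+ + 0)) (interpret-^ ρ (var q) (2 * toℕ i) ρq))
      (trans (cong (ℤ._* ρ b) (interpret-^ ρ (var q) (suc (2 * toℕ i)) ρq))
             (ℤ.*-identityˡ (ρ b))))
    eq

interpret-oddCircle : ∀ n (ρ : Q → ℤ) → ρ q ≡ 1ℤ → interpret ρ (oddCircle n) ≡ + (3 * n)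
interpret-oddCircle n ρ ρq = begin
  interpret ρ (oddCircle n)
    ≡⟨ interpret-· ρ 3 (sum power) ⟩
  + 3 ℤ.* interpret ρ (sum power)
    ≡⟨ cong (+ 3 ℤ.*_) (interpret-sum ρ n power λ i → interpret-^ ρ (var q) (toℕ i) ρq) ⟩
  + 3 ℤ.* (+ n ℤ.* 1ℤ)
    ≡⟨ cong (+ 3 ℤ.*_) (ℤ.*-identityʳ (+ n)) ⟩
  + 3 ℤ.* + n
    ≡⟨ ℤ.pos-* 3 n ⟨
  + (3 * n) ∎
  where
  open ≡-Reasoning

  power : Fin n → Term Q
  power i = var q ^ toℕ i

proposition5p2p1 : (Γ : RibbonGraph) (n : ℕ) .{{_ : NonZero n}} →
    (2 ∣ n →
    evaluateAt (q=1,b=1 n) (evenBracket n (blowup Γ)) ≡ P Γ (+ (3 * n)) ×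
    evaluateAt (q=1,b=-1 n) (evenBracket n (blowup Γ)) ≡ P Γ (+ n)) ×
    (2 ∤ n →
    evaluateAt (q=1 n) (oddBracket n (blowup Γ)) ≡ P Γ (+ (3 * n)))
proposition5p2p1 Γ n =
  (λ 2∣n →
    evaluateAt-penroseBracket (q=1,b=1 n) (evenCircle n) Γ
      -- The constants 3 here and 1 below are `2 + b` at `b = 1` and `b = -1`.
      (interpret-evenCircle _ refl 2∣n 3 refl) ,
    evaluateAt-penroseBracket (q=1,b=-1 n) (evenCircle n) Γ
      (trans (interpret-evenCircle _ refl 2∣n 1 refl) (cong +_ (ℕ.*-identityˡ n)))) ,
  (λ _ → evaluateAt-penroseBracket (q=1 n) (oddCircle n) Γ (interpret-oddCircle n _ refl))
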